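{- Let $n\geq 1$ and let $m,k$ be integers with $m\leq k$. Put $a=\min\{|m|,|k|\}$ and $b=\max\{|m|,|k|\}$. If $mk>0$, then \[(-1)^{\min\{|m|,k\}}\sum_{j=m}^{k}(-1)^j\overline{p}(n-j^2)=op_{2,1}(n,a)+(-1)^{m+k}op_{2,1}(n,b+1),\] and if $mk\leq 0$, then \[(-1)^{\min\{|m|,k\}}\sum_{j=m}^{k}(-1)^j\overline{p}(n-j^2)=op_{2,1}(n,a+1)+(-1)^{m+k}op_{2,1}(n,b+1).\]
   Context: An overpartition of $n$ is a partition of $n$ in which the last occurrence of each part size may be overlined. $\overline{p}(n)$ denotes the number of overpartitions of $n$, with $\overline{p}(0)=1$ and $\overline{p}(n)=0$ for $n<0$. For an overpartition $\pi$, $\overline{mex}_{2,1}(\pi)$ denotes the smallest positive odd integer that does not occur as a non-overlined part of $\pi$. For $n\geq 1$ and $k\geq 0$, $op_{2,1}(n,k)$ denotes the number of overpartitions $\pi$ of $n$ such that $\overline{mex}_{2,1}(\pi)\geq 2k+1$ and $\overline{mex}_{2,1}(\pi)\equiv 2k+1 \pmod 4$. -}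

module Defs where

open import Data.Nat as ℕ using (ℕ; zero; suc)
open import Data.Nat.DivMod using (_%_)
open import Data.Bool using (Bool; true; false; if_then_else_)
open import Data.List using (List; []; _∷_; [_]; concatMap; map; filter; length; upTo)
open import Data.Product using (_×_; _,_)
open import Data.Integer as ℤ using (ℤ; +_; -[1+_]; ∣_∣)
open import Relation.Nullary.Decidable using (_×-dec_)

-- An overpartition of n is encoded by its multiplicity data: the list
-- (c₁ , o₁) ∷ (c₂ , o₂) ∷ … ∷ (c_L , o_L) where c_s is the number of
-- NON-overlined parts equal to s and o_s says whether an overlined part s
-- (the last occurrence of s) is present.  Part size s occurs c_s + [o_s] times.
OPData : Set
OPData = List (ℕ × Bool)

bit : Bool → ℕ
bit true  = 1
bit false = 0

weightFrom : ℕ → OPData → ℕ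
weightFrom s []             = 0
weightFrom s ((c , o) ∷ xs) = s ℕ.* (c ℕ.+ bit o) ℕ.+ weightFrom (suc s) xs

weight : OPData → ℕ
weight = weightFrom 1

allData : ℕ → ℕ → List OPData
allData B zero    = [ [] ]
allData B (suc L) =
  concatMap (λ c → concatMap (λ o → map ((c , o) ∷_) (allData B L)) (true ∷ false ∷ []))
            (upTo (suc B))

-- the overpartitions of n (part sizes 1..n, multiplicities ≤ n, which is no restriction)
overpartitions : ℕ → List OPData
overpartitions n = filter (λ d → weight d ℕ.≟ n) (allData n n)

pbar : ℤ → ℕ
pbar (+ n)    = length (overpartitions n)
pbar -[1+ _ ] = 0

-- index i such that \overline{mex}_{2,1} = 2i+1 : the least i with c_{2i+1} = 0
mexIdx : OPData → ℕ
mexIdx []                       = 0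
mexIdx ((zero , _) ∷ _)         = 0
mexIdx ((suc _ , _) ∷ [])       = 1
mexIdx ((suc _ , _) ∷ _ ∷ xs)   = suc (mexIdx xs)

mex21 : OPData → ℕ
mex21 d = 2 ℕ.* mexIdx d ℕ.+ 1

op21 : ℕ → ℕ → ℕ
op21 n k = length (filter (λ d → ((2 ℕ.* k ℕ.+ 1) ℕ.≤? mex21 d) ×-dec (mex21 d % 4 ℕ.≟ (2 ℕ.* k ℕ.+ 1) % 4))
                          (overpartitions n))

sgn : ℤ → ℤ
sgn j with ∣ j ∣ % 2
... | zero = + 1
... | suc _ = ℤ.- (+ 1)

sumFrom : ℤ → ℕ → (ℤ → ℤ) → ℤ
sumFrom m zero    f = + 0
sumFrom m (suc l) f = f m ℤ.+ sumFrom (m ℤ.+ + 1) l f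

-- Σ_{j=m}^{k} f j   (intended for m ≤ k)
sumFromTo : ℤ → ℤ → (ℤ → ℤ) → ℤ
sumFromTo m k f = sumFrom m (suc ∣ k ℤ.- m ∣) f

{-# OPTIONS --safe #-}
module Submission where

-- Removing one non-overlined copy of each of 1, 3, …, 2k-1 shows that
-- op(n,k) + op(n,k+1) = p̄(n-k²), so (-1)^j p̄(n-j²) is a telescoping difference on
-- j ≥ 0 and, by symmetry, on j ≤ 0.  The two telescopes fit together at j = 0 as soon
-- as op(n,0) = op(n,1), which for n ≥ 1 is Gauss's identity Σ_j (-1)^j q^(j²) · P̄ = 1
-- for the generating function P̄ of overpartitions.
--
-- Gauss's identity comes from a finite form in the style of Shanks.  Let p_L generate
-- the overpartitions with parts at most L, and let V_r = Σ_{s<r} (-1)^s q^(sr) p_s.  Then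
--   p_r · Σ_{∣j∣≤r} (-1)^j q^(j²) = (1 + q^r) V_r + (-1)^r q^(r²) p_r
--                                 = (1 - q^(r+1)) V_{r+1} + (-1)^r q^((r+1)²) p_r,
-- where the second form is 1 + O(q^(r+1)), and induction on r passes from the second
-- form to the first one for r+1 by cancelling 1 - q^(r+1).

open import Defs
open import Data.Bool using (Bool; true; false; _∧_)
open import Data.Integer using (ℤ; +_; -[1+_]; _+_; _-_; _*_; -_; _⊖_; ∣_∣; _⊓_;
  0ℤ; _≤_; _<_; +≤+; -≤+; -≤-; +<+)
import Data.Integer.Properties as ℤₚ
open import Data.Integer.Tactic.RingSolver using (solve-∀)
open import Data.List using (List; []; _∷_; _++_; applyUpTo; concatMap; filter; length; map; upTo)
open import Data.List.Properties using (map-upTo)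
open import Data.Nat as ℕ using (ℕ; zero; suc; z≤n; s≤s; _≡ᵇ_; _≤ᵇ_)
open import Data.Nat.DivMod using (_%_; [m+n]%n≡m%n)
import Data.Nat.Properties as ℕₚ
import Data.Nat.Tactic.RingSolver as ℕ-Solver
open import Data.Product using (_×_; _,_)
open import Data.Sum using (inj₁; inj₂)
open import Function using (_∘_; mk⇔)
open import Relation.Binary.PropositionalEquality
open import Relation.Nullary using (contradiction)
open import Relation.Nullary.Decidable using (does; does-⇔; _×-dec_)
open import Relation.Unary using (Decidable)
open ≡-Reasoning

-- Power series

Series : Set
Series = ℕ → ℤ

infix 4 _≈[_]_
-- Agreement modulo q^(N+1). The enumerations are finite, with bounded multiplicities, so their
-- generating functions obey the product recurrences only up to a certain degree.
_≈[_]_ : Series → ℕ → Series → Set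
f ≈[ N ] g = ∀ {n} → n ℕ.≤ N → f n ≡ g n

infixl 6 _⊕_ _⊝_
_⊕_ _⊝_ : Series → Series → Series
(f ⊕ g) n = f n + g n
(f ⊝ g) n = f n - g n

infixr 7 _·_
_·_ : ℤ → Series → Series
(c · f) n = c * f n

-- Multiplication by q ^ i.
shift : ℕ → Series → Series
shift zero    f n       = f n
shift (suc i) f zero    = + 0
shift (suc i) f (suc n) = shift i f n

shift-cong : ∀ i {f g N} → f ≈[ N ] g → shift i f ≈[ N ] shift i g
shift-cong zero    f≈g n≤N       = f≈g n≤N
shift-cong (suc i) f≈g {zero}  _ = refl
shift-cong (suc i) {N = suc N} f≈g {suc n} (s≤s n≤N) =
  shift-cong i {N = N} (λ m≤N → f≈g (ℕₚ.m≤n⇒m≤1+n m≤N)) n≤N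

-- A shift by at least one reads only strictly lower coefficients; this strictness is what the
-- recursions in `cancel-1-qⁱ` and `geometric-inverts` consume.
shift-cong-< : ∀ i {f g n} → (∀ {m} → m ℕ.< n → f m ≡ g m) →
               shift (suc i) f n ≡ shift (suc i) g n
shift-cong-< i {n = zero}  f≈g = refl
shift-cong-< i {n = suc n} f≈g = shift-cong i {N = n} (λ m≤n → f≈g (s≤s m≤n)) ℕₚ.≤-refl

shift-ext : ∀ i {f g} → (∀ m → f m ≡ g m) → ∀ n → shift i f n ≡ shift i g n
shift-ext i f≡g n = shift-cong i {N = n} (λ {m} _ → f≡g m) ℕₚ.≤-refl

shift-⊕ : ∀ i f g n → shift i (f ⊕ g) n ≡ shift i f n + shift i g n
shift-⊕ zero    f g n       = refl
shift-⊕ (suc i) f g zero    = refl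
shift-⊕ (suc i) f g (suc n) = shift-⊕ i f g n

shift-⊝ : ∀ i f g n → shift i (f ⊝ g) n ≡ shift i f n - shift i g n
shift-⊝ zero    f g n       = refl
shift-⊝ (suc i) f g zero    = refl
shift-⊝ (suc i) f g (suc n) = shift-⊝ i f g n

shift-· : ∀ i c f n → shift i (c · f) n ≡ c * shift i f n
shift-· zero    c f n       = refl
shift-· (suc i) c f zero    = sym (ℤₚ.*-zeroʳ c)
shift-· (suc i) c f (suc n) = shift-· i c f n

shift-0 : ∀ i n → shift i (λ _ → + 0) n ≡ + 0
shift-0 zero    n       = refl
shift-0 (suc i) zero    = refl
shift-0 (suc i) (suc n) = shift-0 i n

shift-shift : ∀ i j f n → shift i (shift j f) n ≡ shift (i ℕ.+ j) f n
shift-shift zero    j f n       = refl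
shift-shift (suc i) j f zero    = refl
shift-shift (suc i) j f (suc n) = shift-shift i j f n

shift-index : ∀ {i j} f n → i ≡ j → shift i f n ≡ shift j f n
shift-index f n refl = refl

shift-comm : ∀ i j f n → shift i (shift j f) n ≡ shift j (shift i f) n
shift-comm i j f n = begin
  shift i (shift j f) n ≡⟨ shift-shift i j f n ⟩
  shift (i ℕ.+ j) f n   ≡⟨ shift-index f n (ℕₚ.+-comm i j) ⟩
  shift (j ℕ.+ i) f n   ≡⟨ shift-shift j i f n ⟨
  shift j (shift i f) n ∎

shift-vanishes : ∀ i f {n} → n ℕ.< i → shift i f n ≡ + 0
shift-vanishes (suc i) f {zero}  _         = refl
shift-vanishes (suc i) f {suc n} (s≤s n<i) = shift-vanishes i f n<i

-- The coefficient of q^m in f is that of (1 - q^(i+1)) f plus a strictly lower coefficient of f (or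
-- 0), so strong induction on m applies, with `b` as its bound. Cancellation stands in for division
-- by 1 - q^(i+1).
cancel-1-qⁱ : ∀ i f g {N} →
              (f ⊝ shift (suc i) f) ≈[ N ] (g ⊝ shift (suc i) g) → f ≈[ N ] g
cancel-1-qⁱ i f g {N} eq {n} = below (suc n) ℕₚ.≤-refl
  where
  regroup : ∀ x y → x ≡ (x - y) + y
  regroup = solve-∀

  below : ∀ b {m} → m ℕ.< b → m ℕ.≤ N → f m ≡ g m
  below (suc b) {m} (s≤s m≤b) m≤N = begin
    f m                       ≡⟨ regroup (f m) (shift (suc i) f m) ⟩
    (f ⊝ shift (suc i) f) m + shift (suc i) f m
      ≡⟨ cong₂ _+_ (eq m≤N) (shift-cong-< i λ l<m →
           below b (ℕₚ.<-≤-trans l<m m≤b) (ℕₚ.≤-trans (ℕₚ.<⇒≤ l<m) m≤N)) ⟩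
    (g ⊝ shift (suc i) g) m + shift (suc i) g m
      ≡⟨ regroup (g m) (shift (suc i) g m) ⟨
    g m                       ∎

-- Gauss's identity

sg : ℕ → ℤ
sg zero    = + 1
sg (suc n) = - sg n

-- Multiplication by Σ_{∣j∣≤r} (-1)^j q^(j²).
theta : ℕ → Series → Series
theta zero    f = f
theta (suc r) f = theta r f ⊕ (+ 2 * sg (suc r)) · shift (suc r ℕ.* suc r) f

theta-cong : ∀ r {f g N} → f ≈[ N ] g → theta r f ≈[ N ] theta r g
theta-cong zero    f≈g n≤N = f≈g n≤N
theta-cong (suc r) f≈g n≤N =
  cong₂ _+_ (theta-cong r f≈g n≤N)
            (cong (+ 2 * sg (suc r) *_) (shift-cong (suc r ℕ.* suc r) f≈g n≤N))

theta-⊕ : ∀ r f g n → theta r (f ⊕ g) n ≡ theta r f n + theta r g n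
theta-⊕ zero    f g n = refl
theta-⊕ (suc r) f g n
  rewrite theta-⊕ r f g n | shift-⊕ (suc r ℕ.* suc r) f g n =
  lemma (+ 2 * sg (suc r)) (theta r f n) (theta r g n)
    (shift (suc r ℕ.* suc r) f n) (shift (suc r ℕ.* suc r) g n)
  where
  lemma : ∀ c x y z w → (x + y) + c * (z + w) ≡ (x + c * z) + (y + c * w)
  lemma = solve-∀

theta-⊝ : ∀ r f g n → theta r (f ⊝ g) n ≡ theta r f n - theta r g n
theta-⊝ zero    f g n = refl
theta-⊝ (suc r) f g n
  rewrite theta-⊝ r f g n | shift-⊝ (suc r ℕ.* suc r) f g n =
  lemma (+ 2 * sg (suc r)) (theta r f n) (theta r g n)
    (shift (suc r ℕ.* suc r) f n) (shift (suc r ℕ.* suc r) g n)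
  where
  lemma : ∀ c x y z w → (x - y) + c * (z - w) ≡ (x + c * z) - (y + c * w)
  lemma = solve-∀

theta-shift : ∀ r i f n → theta r (shift i f) n ≡ shift i (theta r f) n
theta-shift zero    i f n = refl
theta-shift (suc r) i f n
  rewrite shift-⊕ i (theta r f) ((+ 2 * sg (suc r)) · shift (suc r ℕ.* suc r) f) n
        | shift-· i (+ 2 * sg (suc r)) (shift (suc r ℕ.* suc r) f) n
        | theta-shift r i f n
        | shift-comm i (suc r ℕ.* suc r) f n = refl

-- Only the recurrence (1 - q^(L+1)) p_(L+1) = (1 + q^(L+1)) p_L enters, so p_0 stays arbitrary
-- here.
module Gauss
  (N : ℕ) (p : ℕ → Series)
  (p-step : ∀ L → (p (suc L) ⊝ shift (suc L) (p (suc L))) ≈[ N ] (p L ⊕ shift (suc L) (p L)))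
  where

  -- Σ_{s<m} (-1)^s q^(sr) p_s
  V : ℕ → ℕ → Series
  V r zero    = λ _ → + 0
  V r (suc m) = V r m ⊕ sg m · shift (m ℕ.* r) (p m)

  shift-V : ∀ i r m n → shift i (V r (suc m)) n
                        ≡ shift i (V r m) n + sg m * shift (i ℕ.+ m ℕ.* r) (p m) n
  shift-V i r m n
    rewrite shift-⊕ i (V r m) (sg m · shift (m ℕ.* r) (p m)) n
          | shift-· i (sg m) (shift (m ℕ.* r) (p m)) n
          | shift-shift i (m ℕ.* r) (p m) n = refl

  -- The recurrence rearranges to p_(m+1) - p_m = q^(m+1) (p_m + p_(m+1)); the factor q^((m+1)r)
  -- raises the exponent on the right to (m+1)(r+1).
  shift-difference : ∀ m r →
    (shift (suc m ℕ.* r) (p (suc m)) ⊝ shift (suc m ℕ.* r) (p m)) ≈[ N ]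
    (shift (suc m ℕ.* suc r) (p m) ⊕ shift (suc m ℕ.* suc r) (p (suc m)))
  shift-difference m r {n} n≤N = begin
    shift i (p (suc m)) n - shift i (p m) n
      ≡⟨ shift-⊝ i (p (suc m)) (p m) n ⟨
    shift i (p (suc m) ⊝ p m) n
      ≡⟨ shift-cong i (λ {k} k≤N → move (p (suc m) k) _ (p m k) _ (p-step m k≤N)) n≤N ⟩
    shift i (shift (suc m) (p m) ⊕ shift (suc m) (p (suc m))) n
      ≡⟨ shift-⊕ i (shift (suc m) (p m)) (shift (suc m) (p (suc m))) n ⟩
    shift i (shift (suc m) (p m)) n + shift i (shift (suc m) (p (suc m))) n
      ≡⟨ cong₂ _+_ (merge (p m)) (merge (p (suc m))) ⟩
    shift (suc m ℕ.* suc r) (p m) n + shift (suc m ℕ.* suc r) (p (suc m)) n ∎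
    where
    i = suc m ℕ.* r

    merge : ∀ f → shift i (shift (suc m) f) n ≡ shift (suc m ℕ.* suc r) f n
    merge f = trans (shift-shift i (suc m) f n)
      (shift-index f n (trans (ℕₚ.+-comm i (suc m)) (sym (ℕₚ.*-suc (suc m) r))))

    move : ∀ x x' y y' → x - x' ≡ y + y' → x - y ≡ y' + x'
    move x x' y y' eq = begin
      x - y                ≡⟨ l₁ x x' y ⟩
      (x - x') + (x' - y)  ≡⟨ cong (_+ (x' - y)) eq ⟩
      (y + y') + (x' - y)  ≡⟨ l₂ x' y y' ⟩
      y' + x'              ∎
      where
      l₁ : ∀ x x' y → x - y ≡ (x - x') + (x' - y)
      l₁ = solve-∀
      l₂ : ∀ x' y y' → (y + y') + (x' - y) ≡ y' + x'
      l₂ = solve-∀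

  -- Equality of the two forms is wanted only for m = r. Freeing the length m of the sum from the
  -- exponent r permits induction on m.
  V-exchange : ∀ r m →
    ((V r m ⊕ shift r (V r m)) ⊕ sg m · shift (m ℕ.* r) (p m)) ≈[ N ]
    ((V (suc r) (suc m) ⊝ shift (suc r) (V (suc r) (suc m)))
      ⊕ sg m · shift (suc m ℕ.* suc r) (p m))
  V-exchange r zero {n} n≤N
    rewrite shift-0 r n
          | shift-V (suc r) (suc r) 0 n
          | shift-0 (suc r) n
          = lemma (p 0 n) (shift (suc r ℕ.+ 0) (p 0) n)
    where
    lemma : ∀ x y → (+ 0 + + 0) + + 1 * x
                    ≡ ((+ 0 + + 1 * x) - (+ 0 + + 1 * y)) + + 1 * y
    lemma = solve-∀
  V-exchange r (suc m) {n} n≤N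
    rewrite shift-V r r m n
          | shift-V (suc r) (suc r) (suc m) n
          = begin
    ((v + e * a) + (v' + e * b)) + - e * c
      ≡⟨ l₁ e v v' a b c ⟩
    ((v + v') + e * a) + - e * (c - b)
      -- Here `b` comes from the last term of q^r V_r and `c` is the new boundary term. In their
      -- difference `d + f`, `d` cancels the old boundary term and `f` supplies the next term of
      -- V_(r+1).
      ≡⟨ cong₂ (λ x y → x + - e * y) (V-exchange r m n≤N) (shift-difference m r n≤N) ⟩
    ((w - w') + e * d) + - e * (d + f)
      ≡⟨ l₂ e w w' d f g ⟩
    ((w + - e * f) - (w' + - e * g)) + - e * g ∎
    where
    e = sg m
    v = V r m n
    v' = shift r (V r m) n
    a = shift (m ℕ.* r) (p m) n
    b = shift (suc m ℕ.* r) (p m) n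
    c = shift (suc m ℕ.* r) (p (suc m)) n
    w = V (suc r) (suc m) n
    w' = shift (suc r) (V (suc r) (suc m)) n
    d = shift (suc m ℕ.* suc r) (p m) n
    f = shift (suc m ℕ.* suc r) (p (suc m)) n
    g = shift (suc (suc m) ℕ.* suc r) (p (suc m)) n
    l₁ : ∀ e v v' a b c → ((v + e * a) + (v' + e * b)) + - e * c
                          ≡ ((v + v') + e * a) + - e * (c - b)
    l₁ = solve-∀
    l₂ : ∀ e w w' d f g → ((w - w') + e * d) + - e * (d + f)
                          ≡ ((w + - e * f) - (w' + - e * g)) + - e * g
    l₂ = solve-∀

  -- Mutual recursion between the two forms: `theta-p′ r` is `theta-p r` followed by `V-exchange` on
  -- the diagonal m = r, and `theta-p (suc r)` rests on `theta-p′ r`.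
  theta-p : ∀ r → theta r (p r) ≈[ N ]
    ((V r r ⊕ shift r (V r r)) ⊕ sg r · shift (r ℕ.* r) (p r))
  theta-p′ : ∀ r → theta r (p r) ≈[ N ]
    ((V (suc r) (suc r) ⊝ shift (suc r) (V (suc r) (suc r)))
      ⊕ sg r · shift (suc r ℕ.* suc r) (p r))

  theta-p zero {n} n≤N = lemma (p 0 n)
    where
    lemma : ∀ x → x ≡ (+ 0 + + 0) + + 1 * x
    lemma = solve-∀
  theta-p (suc r) {n} n≤N = begin
    -- `R` is the claimed value less the new terms 2 e y of theta. That `Q` equals `R` is checked
    -- after multiplication by 1 - q^(r+1), where the recurrence leads from p_(r+1) back to p_r and
    -- the second form for r applies.
    Q n + (+ 2 * e) * y n ≡⟨ cong (_+ (+ 2 * e) * y n) (cancel-1-qⁱ r Q R Q-R n≤N) ⟩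
    R n + (+ 2 * e) * y n ≡⟨ l₁ e (v n) (shift i v n) (y n) ⟩
    (v n + shift i v n) + e * y n ∎
    where
    i = suc r
    e = sg i
    v = V i i
    y = shift (i ℕ.* i) (p i)
    z = shift (i ℕ.* i) (p r)
    Q = theta r (p i)
    R = (v ⊕ shift i v) ⊝ e · y

    l₁ : ∀ e v v' y → ((v + v') - e * y) + (+ 2 * e) * y ≡ (v + v') + e * y
    l₁ = solve-∀
    l₂ : ∀ e x x₁ x₂ z z₁ → ((x - x₁) + e * z) + ((x₁ - x₂) + e * z₁)
                            ≡ (x - x₂) - - e * (z + z₁)
    l₂ = solve-∀
    l₃ : ∀ e x x₁ x₂ y y₁ → (x - x₂) - e * (y - y₁)
                            ≡ ((x + x₁) - e * y) - ((x₁ + x₂) - e * y₁)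
    l₃ = solve-∀

    -- The recurrence multiplied by q^(i²), the power of q in the boundary terms of both `T` and
    -- `R`.
    y-z : (z ⊕ shift i z) ≈[ N ] (y ⊝ shift i y)
    y-z {k} k≤N = begin
      z k + shift i z k
        ≡⟨ cong (λ x → z k + x) (shift-comm i (i ℕ.* i) (p r) k) ⟩
      z k + shift (i ℕ.* i) (shift i (p r)) k
        ≡⟨ shift-⊕ (i ℕ.* i) (p r) (shift i (p r)) k ⟨
      shift (i ℕ.* i) (p r ⊕ shift i (p r)) k
        ≡⟨ shift-cong (i ℕ.* i) (p-step r) k≤N ⟨
      shift (i ℕ.* i) (p i ⊝ shift i (p i)) k
        ≡⟨ shift-⊝ (i ℕ.* i) (p i) (shift i (p i)) k ⟩
      y k - shift (i ℕ.* i) (shift i (p i)) k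
        ≡⟨ cong (λ x → y k - x) (shift-comm (i ℕ.* i) i (p i) k) ⟩
      y k - shift i y k ∎

    T = (v ⊝ shift i v) ⊕ sg r · z

    shift-T : ∀ k → shift i T k
                    ≡ (shift i v k - shift i (shift i v) k) + sg r * shift i z k
    shift-T k
      rewrite shift-⊕ i (v ⊝ shift i v) (sg r · z) k
            | shift-⊝ i v (shift i v) k
            | shift-· i (sg r) z k = refl

    shift-R : ∀ k → shift i R k
                    ≡ (shift i v k + shift i (shift i v) k) - e * shift i y k
    shift-R k
      rewrite shift-⊝ i (v ⊕ shift i v) (e · y) k
            | shift-⊕ i v (shift i v) k
            | shift-· i e y k = refl

    Q-R : (Q ⊝ shift i Q) ≈[ N ] (R ⊝ shift i R)
    Q-R {k} k≤N = begin
      Q k - shift i Q k                   ≡⟨ cong (λ x → Q k - x) (theta-shift r i (p i) k) ⟨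
      Q k - theta r (shift i (p i)) k     ≡⟨ theta-⊝ r (p i) (shift i (p i)) k ⟨
      theta r (p i ⊝ shift i (p i)) k     ≡⟨ theta-cong r (p-step r) k≤N ⟩
      theta r (p r ⊕ shift i (p r)) k     ≡⟨ theta-⊕ r (p r) (shift i (p r)) k ⟩
      theta r (p r) k + theta r (shift i (p r)) k
        ≡⟨ cong (λ x → theta r (p r) k + x) (theta-shift r i (p r) k) ⟩
      theta r (p r) k + shift i (theta r (p r)) k
        ≡⟨ cong₂ _+_ (theta-p′ r k≤N) (shift-cong i (theta-p′ r) k≤N) ⟩
      T k + shift i T k                   ≡⟨ cong (λ x → T k + x) (shift-T k) ⟩
      T k + ((shift i v k - shift i (shift i v) k) + sg r * shift i z k)
        ≡⟨ l₂ (sg r) (v k) (shift i v k) (shift i (shift i v) k) (z k) (shift i z k) ⟩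
      (v k - shift i (shift i v) k) - e * (z k + shift i z k)
        ≡⟨ cong (λ x → (v k - shift i (shift i v) k) - e * x) (y-z k≤N) ⟩
      (v k - shift i (shift i v) k) - e * (y k - shift i y k)
        ≡⟨ l₃ e (v k) (shift i v k) (shift i (shift i v) k) (y k) (shift i y k) ⟩
      R k - ((shift i v k + shift i (shift i v) k) - e * shift i y k)
        ≡⟨ cong (λ x → R k - x) (shift-R k) ⟨
      R k - shift i R k ∎

  theta-p′ r n≤N = trans (theta-p r n≤N) (V-exchange r r n≤N)

  -- The term of index s carries q^(s(n+1)), so at q^n only s = 0 survives.
  V-low : ∀ n m → V (suc n) (suc m) n ≡ p 0 n
  V-low n zero    = trans (ℤₚ.+-identityˡ _) (ℤₚ.*-identityˡ _)
  V-low n (suc m)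
    rewrite shift-vanishes (suc m ℕ.* suc n) (p (suc m)) {n} (s≤s (ℕₚ.m≤m+n n _))
          | ℤₚ.*-zeroʳ (sg (suc m)) = trans (ℤₚ.+-identityʳ _) (V-low n m)

  -- In the second form with r = N every contribution except that of p_0 starts beyond q^N.
  theta-p-diagonal : theta N (p N) N ≡ p 0 N
  theta-p-diagonal
    rewrite theta-p′ N ℕₚ.≤-refl
          | V-low N N
          | shift-vanishes (suc N) (V (suc N) (suc N)) {N} ℕₚ.≤-refl
          | shift-vanishes (suc N ℕ.* suc N) (p N) {N} (s≤s (ℕₚ.m≤m+n N _))
          | ℤₚ.*-zeroʳ (sg N) = lemma (p 0 N)
    where
    lemma : ∀ x → (x - + 0) + + 0 ≡ x
    lemma = solve-∀

-- Generating functions of overpartition data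

sumOver : {A : Set} → (A → ℤ) → List A → ℤ
sumOver F []       = + 0
sumOver F (x ∷ xs) = F x + sumOver F xs

module _ {A : Set} where

  sumOver-cong : {F G : A → ℤ} → (∀ x → F x ≡ G x) → ∀ xs → sumOver F xs ≡ sumOver G xs
  sumOver-cong F≡G []       = refl
  sumOver-cong F≡G (x ∷ xs) = cong₂ _+_ (F≡G x) (sumOver-cong F≡G xs)

  sumOver-+ : ∀ (F G : A → ℤ) xs →
              sumOver (λ x → F x + G x) xs ≡ sumOver F xs + sumOver G xs
  sumOver-+ F G []       = refl
  sumOver-+ F G (x ∷ xs) rewrite sumOver-+ F G xs =
    interchange (F x) (G x) (sumOver F xs) (sumOver G xs)
    where
    interchange : ∀ a b c d → a + b + (c + d) ≡ a + c + (b + d)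
    interchange = solve-∀

  sumOver-zero : {F : A → ℤ} → (∀ x → F x ≡ + 0) → ∀ xs → sumOver F xs ≡ + 0
  sumOver-zero F≡0 []       = refl
  sumOver-zero F≡0 (x ∷ xs) = cong₂ _+_ (F≡0 x) (sumOver-zero F≡0 xs)

  sumOver-++ : ∀ (F : A → ℤ) xs ys → sumOver F (xs ++ ys) ≡ sumOver F xs + sumOver F ys
  sumOver-++ F []       ys = sym (ℤₚ.+-identityˡ _)
  sumOver-++ F (x ∷ xs) ys rewrite sumOver-++ F xs ys = sym (ℤₚ.+-assoc (F x) _ _)

  sumOver-map : {B : Set} (F : A → ℤ) (g : B → A) → ∀ xs →
                sumOver F (map g xs) ≡ sumOver (F ∘ g) xs
  sumOver-map F g []       = refl
  sumOver-map F g (x ∷ xs) = cong (λ y → F (g x) + y) (sumOver-map F g xs)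

  sumOver-concatMap : {B : Set} (F : A → ℤ) (g : B → List A) → ∀ xs →
                      sumOver F (concatMap g xs) ≡ sumOver (λ x → sumOver F (g x)) xs
  sumOver-concatMap F g []       = refl
  sumOver-concatMap F g (x ∷ xs) =
    trans (sumOver-++ F (g x) (concatMap g xs))
          (cong (λ y → sumOver F (g x) + y) (sumOver-concatMap F g xs))

  shift-sumOver : ∀ i (h : A → Series) xs n →
                  shift i (λ m → sumOver (λ x → h x m) xs) n
                  ≡ sumOver (λ x → shift i (h x) n) xs
  shift-sumOver i h []       n = shift-0 i n
  shift-sumOver i h (x ∷ xs) n =
    trans (shift-⊕ i (h x) (λ m → sumOver (λ y → h y m) xs) n)
          (cong (λ y → shift i (h x) n + y) (shift-sumOver i h xs n))

𝟙 : Bool → ℤ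
𝟙 b = + bit b

module _ {A : Set} {P : A → Set} (P? : Decidable P) where

  length-filter : ∀ xs → + length (filter P? xs) ≡ sumOver (𝟙 ∘ does ∘ P?) xs
  length-filter []       = refl
  length-filter (x ∷ xs) with does (P? x)
  ... | true  = trans (ℤₚ.pos-+ 1 (length (filter P? xs))) (cong (λ y → + 1 + y) (length-filter xs))
  ... | false = trans (length-filter xs) (sym (ℤₚ.+-identityˡ _))

  sumOver-filter : ∀ F xs → sumOver F (filter P? xs)
                            ≡ sumOver (λ x → F x * 𝟙 (does (P? x))) xs
  sumOver-filter F []       = refl
  sumOver-filter F (x ∷ xs) with does (P? x)
  ... | true  = cong₂ _+_ (sym (ℤₚ.*-identityʳ (F x))) (sumOver-filter F xs)
  ... | false = trans (sumOver-filter F xs)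
    (trans (sym (ℤₚ.+-identityˡ _)) (cong (_+ sumOver _ xs) (sym (ℤₚ.*-zeroʳ (F x)))))

-- Truncated geometric series

geometric : ℕ → ℕ → Series → Series
geometric s N h n = sumOver (λ c → shift (s ℕ.* c) h n) (upTo N)

geometric-suc : ∀ s N h n → geometric s (suc N) h n ≡ h n + shift s (geometric s N h) n
geometric-suc s N h n = cong₂ _+_ (shift-index h n (ℕₚ.*-zeroʳ s)) (begin
  sumOver f (applyUpTo suc N)
    ≡⟨ cong (sumOver f) (map-upTo suc N) ⟨
  sumOver f (map suc (upTo N))
    ≡⟨ sumOver-map f suc (upTo N) ⟩
  sumOver (f ∘ suc) (upTo N)
    ≡⟨ sumOver-cong (λ c → trans (shift-index h n (ℕₚ.*-suc s c))
                                 (sym (shift-shift s (s ℕ.* c) h n))) (upTo N) ⟩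
  sumOver (λ c → shift s (shift (s ℕ.* c) h) n) (upTo N)
    ≡⟨ shift-sumOver s (λ c → shift (s ℕ.* c) h) (upTo N) n ⟨
  shift s (geometric s N h) n ∎)
  where f = λ c → shift (s ℕ.* c) h n

-- The product is h (1 - q^(sN)), whose error term starts beyond q^n. In the induction, the shift by
-- s ≥ 1 lowers the degree and so pays for the drop in N.
geometric-inverts : ∀ t N h {n} → n ℕ.< N →
                    (geometric (suc t) N h ⊝ shift (suc t) (geometric (suc t) N h)) n ≡ h n
geometric-inverts t (suc N) h {n} (s≤s n≤N) = begin
  G′ n - shift s G′ n
    ≡⟨ cong₂ _-_ (geometric-suc s N h n) (shift-ext s (geometric-suc s N h) n) ⟩
  (h n + shift s G n) - shift s (h ⊕ shift s G) n
    ≡⟨ cong (λ x → (h n + shift s G n) - x) (shift-⊕ s h (shift s G) n) ⟩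
  (h n + shift s G n) - (shift s h n + shift s (shift s G) n)
    ≡⟨ regroup (h n) (shift s G n) (shift s h n) _ ⟩
  h n + ((shift s G n - shift s (shift s G) n) - shift s h n)
    ≡⟨ cong (λ x → h n + (x - shift s h n)) (shift-⊝ s G (shift s G) n) ⟨
  h n + (shift s (G ⊝ shift s G) n - shift s h n)
    ≡⟨ cong (λ x → h n + (x - shift s h n))
         (shift-cong-< t (λ m<n → geometric-inverts t N h (ℕₚ.<-≤-trans m<n n≤N))) ⟩
  h n + (shift s h n - shift s h n)
    ≡⟨ collapse (h n) (shift s h n) ⟩
  h n ∎
  where
  s  = suc t
  G  = geometric s N h
  G′ = geometric s (suc N) h
  regroup : ∀ a b c d → (a + b) - (c + d) ≡ a + ((b - d) - c)
  regroup = solve-∀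
  collapse : ∀ a b → a + (b - b) ≡ a
  collapse = solve-∀

-- Generating function, weighted by F, of the data with L entries bounded by B
-- in which the first entry stands for part size s; B truncates it beyond q^B.
gf : ℕ → ℕ → ℕ → (OPData → ℤ) → Series
gf B s L F n = sumOver (λ d → F d * 𝟙 (weightFrom s d ≡ᵇ n)) (allData B L)

gf-cong : ∀ B s L {F G} → (∀ d → F d ≡ G d) → ∀ n → gf B s L F n ≡ gf B s L G n
gf-cong B s L F≡G n = sumOver-cong (λ d → cong (_* 𝟙 (weightFrom s d ≡ᵇ n)) (F≡G d)) (allData B L)

shift-𝟙 : ∀ i w n → shift i (λ m → 𝟙 (w ≡ᵇ m)) n ≡ 𝟙 (i ℕ.+ w ≡ᵇ n)
shift-𝟙 zero    w n       = refl
shift-𝟙 (suc i) w zero    = refl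
shift-𝟙 (suc i) w (suc n) = shift-𝟙 i w n

optionalOverline : ℕ → Series → Series
optionalOverline s f = f ⊕ shift s f

withCount : ℕ → ℕ → ℕ → (OPData → ℤ) → ℕ → Series
withCount B s L F c =
  shift (s ℕ.* c) (gf B (suc s) L (λ d → F ((c , false) ∷ d)))
    ⊕ shift (s ℕ.* c) (shift s (gf B (suc s) L (λ d → F ((c , true) ∷ d))))

-- Splitting off the first entry `(c , o)` releases the factor q^(s(c + bit o)) and leaves data
-- whose part sizes start at s + 1.
gf-unfold : ∀ B s L F n →
  gf B s (suc L) F n ≡ sumOver (λ c → withCount B s L F c n) (upTo (suc B))
gf-unfold B s L F n =
  trans (sumOver-concatMap W prefixed (upTo (suc B))) (sumOver-cong perCount (upTo (suc B)))
  where
  W = λ d → F d * 𝟙 (weightFrom s d ≡ᵇ n)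

  prefixed : ℕ → List OPData
  prefixed c = concatMap (λ o → map ((c , o) ∷_) (allData B L)) (true ∷ false ∷ [])

  perPart : ∀ c o → sumOver W (map ((c , o) ∷_) (allData B L))
                    ≡ shift (s ℕ.* (c ℕ.+ bit o)) (gf B (suc s) L (λ d → F ((c , o) ∷ d))) n
  perPart c o = begin
    sumOver W (map ((c , o) ∷_) (allData B L))
      ≡⟨ sumOver-map W ((c , o) ∷_) (allData B L) ⟩
    sumOver (W ∘ ((c , o) ∷_)) (allData B L)
      ≡⟨ sumOver-cong (λ d → trans
           (cong (F ((c , o) ∷ d) *_) (sym (shift-𝟙 i (weightFrom (suc s) d) n)))
           (sym (shift-· i (F ((c , o) ∷ d)) (λ m → 𝟙 (weightFrom (suc s) d ≡ᵇ m)) n)))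
           (allData B L) ⟩
    sumOver (λ d → shift i (F ((c , o) ∷ d) · (λ m → 𝟙 (weightFrom (suc s) d ≡ᵇ m))) n) (allData B L)
      ≡⟨ shift-sumOver i (λ d → F ((c , o) ∷ d) · (λ m → 𝟙 (weightFrom (suc s) d ≡ᵇ m))) (allData B L) n ⟨
    shift i (gf B (suc s) L (λ d → F ((c , o) ∷ d))) n ∎
    where i = s ℕ.* (c ℕ.+ bit o)

  perCount : ∀ c → sumOver W (prefixed c) ≡ withCount B s L F c n
  perCount c = begin
    sumOver W (prefixed c)
      ≡⟨ sumOver-concatMap W (λ o → map ((c , o) ∷_) (allData B L)) (true ∷ false ∷ []) ⟩
    sumOver W (map ((c , true) ∷_) (allData B L))
      + (sumOver W (map ((c , false) ∷_) (allData B L)) + + 0)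
      ≡⟨ cong₂ (λ x y → x + (y + + 0)) (perPart c true) (perPart c false) ⟩
    shift (s ℕ.* (c ℕ.+ 1)) T n + (shift (s ℕ.* (c ℕ.+ 0)) U n + + 0)
      ≡⟨ cong₂ (λ x y → x + (y + + 0))
           (trans (shift-index T n (s[c+1] s c)) (sym (shift-shift (s ℕ.* c) s T n)))
           (shift-index U n (cong (s ℕ.*_) (ℕₚ.+-identityʳ c))) ⟩
    shift (s ℕ.* c) (shift s T) n + (shift (s ℕ.* c) U n + + 0)
      ≡⟨ swap (shift (s ℕ.* c) (shift s T) n) (shift (s ℕ.* c) U n) ⟩
    shift (s ℕ.* c) U n + shift (s ℕ.* c) (shift s T) n ∎
    where
    T = gf B (suc s) L (λ d → F ((c , true) ∷ d))
    U = gf B (suc s) L (λ d → F ((c , false) ∷ d))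
    s[c+1] : ∀ s c → s ℕ.* (c ℕ.+ 1) ≡ s ℕ.* c ℕ.+ s
    s[c+1] = ℕ-Solver.solve-∀
    swap : ∀ x y → x + (y + + 0) ≡ y + x
    swap = solve-∀

withCount-uniform : ∀ B s L F H c → (∀ o d → F ((c , o) ∷ d) ≡ H d) → ∀ n →
  withCount B s L F c n ≡ shift (s ℕ.* c) (optionalOverline s (gf B (suc s) L H)) n
withCount-uniform B s L F H c F≡H n =
  trans (cong₂ _+_
          (shift-ext i (gf-cong B (suc s) L (F≡H false)) n)
          (shift-ext i (shift-ext s (gf-cong B (suc s) L (F≡H true))) n))
        (sym (shift-⊕ i (gf B (suc s) L H) (shift s (gf B (suc s) L H)) n))
  where i = s ℕ.* c

-- A free multiplicity contributes the factor 1/(1 - q^s), here moved to the left side; the counts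
-- 0, ..., B give enough of the geometric series for degrees up to B.
gf-anyCount : ∀ B t L F H → (∀ c o d → F ((c , o) ∷ d) ≡ H d) →
  (gf B (suc t) (suc L) F ⊝ shift (suc t) (gf B (suc t) (suc L) F))
    ≈[ B ] optionalOverline (suc t) (gf B (suc (suc t)) L H)
gf-anyCount B t L F H F≡H {n} n≤B =
  trans (cong₂ _-_ (as-geometric n) (shift-ext (suc t) as-geometric n))
        (geometric-inverts t (suc B) h (s≤s n≤B))
  where
  h = optionalOverline (suc t) (gf B (suc (suc t)) L H)
  as-geometric : ∀ n → gf B (suc t) (suc L) F n ≡ geometric (suc t) (suc B) h n
  as-geometric n = trans (gf-unfold B (suc t) L F n)
    (sumOver-cong {F = λ c → withCount B (suc t) L F c n}
                  (λ c → withCount-uniform B (suc t) L F H c (F≡H c) n) (upTo (suc B)))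

gf-zero : ∀ B s L {F} → (∀ d → F d ≡ + 0) → ∀ n → gf B s L F n ≡ + 0
gf-zero B s L F≡0 n =
  sumOver-zero (λ d → cong (_* 𝟙 (weightFrom s d ≡ᵇ n)) (F≡0 d)) (allData B L)

-- The count 0 contributes nothing, so the geometric series starts one step later, at q^s.
gf-positiveCount : ∀ B t L F H →
  (∀ o d → F ((0 , o) ∷ d) ≡ + 0) → (∀ c o d → F ((suc c , o) ∷ d) ≡ H d) →
  (gf B (suc t) (suc L) F ⊝ shift (suc t) (gf B (suc t) (suc L) F))
    ≈[ B ] shift (suc t) (optionalOverline (suc t) (gf B (suc (suc t)) L H))
gf-positiveCount B t L F H F≡0 F≡H {n} n≤B = begin
  gf B s (suc L) F n - shift s (gf B s (suc L) F) n
    ≡⟨ cong₂ _-_ (as-geometric n) (shift-ext s as-geometric n) ⟩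
  shift s G n - shift s (shift s G) n
    ≡⟨ shift-⊝ s G (shift s G) n ⟨
  shift s (G ⊝ shift s G) n
    -- Only B counts remain, one fewer than in `gf-anyCount`; they suffice because the outer shift
    -- asks only for degrees below n ≤ B.
    ≡⟨ shift-cong-< t (λ m<n → geometric-inverts t B h (ℕₚ.<-≤-trans m<n n≤B)) ⟩
  shift s h n ∎
  where
  s = suc t
  h = optionalOverline s (gf B (suc s) L H)
  G = geometric s B h

  f = withCount B s L F

  f-zero : ∀ n → f 0 n ≡ + 0
  f-zero n = cong₂ _+_
    (trans (shift-ext i (gf-zero B (suc s) L (F≡0 false)) n)
           (shift-0 i n))
    (trans (shift-ext i (shift-ext s (gf-zero B (suc s) L (F≡0 true))) n)
           (trans (shift-shift i s _ n) (shift-0 (i ℕ.+ s) n)))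
    where i = s ℕ.* 0

  as-geometric : ∀ n → gf B s (suc L) F n ≡ shift s G n
  as-geometric n = begin
    gf B s (suc L) F n
      ≡⟨ gf-unfold B s L F n ⟩
    f 0 n + sumOver (λ c → f c n) (applyUpTo suc B)
      ≡⟨ cong₂ _+_ (f-zero n) (cong (sumOver (λ c → f c n)) (sym (map-upTo suc B))) ⟩
    + 0 + sumOver (λ c → f c n) (map suc (upTo B))
      ≡⟨ ℤₚ.+-identityˡ _ ⟩
    sumOver (λ c → f c n) (map suc (upTo B))
      ≡⟨ sumOver-map (λ c → f c n) suc (upTo B) ⟩
    sumOver (λ c → f (suc c) n) (upTo B)
      ≡⟨ sumOver-cong (λ c → trans (withCount-uniform B s L F H (suc c) (F≡H c) n)
           (trans (shift-index h n (ℕₚ.*-suc s c)) (sym (shift-shift s (s ℕ.* c) h n)))) (upTo B) ⟩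
    sumOver (λ c → shift s (shift (s ℕ.* c) h) n) (upTo B)
      ≡⟨ shift-sumOver s (λ c → shift (s ℕ.* c) h) (upTo B) n ⟨
    shift s G n ∎

-- Product recurrences for all overpartition data

one : OPData → ℤ
one _ = + 1

gf-one-first : ∀ B t L → let C = gf B (suc t) (suc L) one in
  (C ⊝ shift (suc t) C) ≈[ B ] optionalOverline (suc t) (gf B (suc (suc t)) L one)
gf-one-first B t L = gf-anyCount B t L one one (λ _ _ _ → refl)

shift-twisted : ∀ i j f n →
  shift i (f ⊝ shift j f) n ≡ (shift i f ⊝ shift j (shift i f)) n
shift-twisted i j f n = trans (shift-⊝ i f (shift j f) n)
  (cong (λ x → shift i f n - x) (shift-comm i j f n))

shift-overline : ∀ i j f n →
  shift i (optionalOverline j f) n ≡ optionalOverline j (shift i f) n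
shift-overline i j f n = trans (shift-⊕ i f (shift j f) n)
  (cong (λ x → shift i f n + x) (shift-comm i j f n))

overline-cong : ∀ s {f g N} → f ≈[ N ] g → optionalOverline s f ≈[ N ] optionalOverline s g
overline-cong s f≈g n≤N = cong₂ _+_ (f≈g n≤N) (shift-cong s f≈g n≤N)

overline-⊝ : ∀ s f g n → optionalOverline s (f ⊝ g) n
                         ≡ (optionalOverline s f ⊝ optionalOverline s g) n
overline-⊝ s f g n rewrite shift-⊝ s f g n = lemma (f n) (g n) (shift s f n) (shift s g n)
  where
  lemma : ∀ a b c d → (a - b) + (c - d) ≡ (a + c) - (b + d)
  lemma = solve-∀

overline-comm : ∀ i j f n → optionalOverline i (optionalOverline j f) n
                            ≡ optionalOverline j (optionalOverline i f) n
overline-comm i j f n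
  rewrite shift-⊕ i f (shift j f) n | shift-⊕ j f (shift i f) n | shift-comm i j f n =
  lemma (f n) (shift j f n) (shift i f n) (shift j (shift i f) n)
  where
  lemma : ∀ a b c d → (a + b) + (c + d) ≡ (a + c) + (b + d)
  lemma = solve-∀

twist-comm : ∀ i j f n → ((f ⊝ shift j f) ⊝ shift i (f ⊝ shift j f)) n
                         ≡ ((f ⊝ shift i f) ⊝ shift j (f ⊝ shift i f)) n
twist-comm i j f n
  rewrite shift-⊝ i f (shift j f) n | shift-⊝ j f (shift i f) n | shift-comm i j f n =
  lemma (f n) (shift j f n) (shift i f n) (shift j (shift i f) n)
  where
  lemma : ∀ a b c d → (a - b) - (c - d) ≡ (a - c) - (b - d)
  lemma = solve-∀

twist-cong : ∀ s {f g N} → f ≈[ N ] g → (f ⊝ shift s f) ≈[ N ] (g ⊝ shift s g)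
twist-cong s f≈g n≤N = cong₂ _-_ (f≈g n≤N) (shift-cong s f≈g n≤N)

-- This is the recurrence required by `Gauss`. The data are built from the smallest size, whereas
-- the recurrence adds the largest: the smallest size is peeled off, the induction hypothesis is
-- applied to the rest, the commuting factors are exchanged, and 1 - q^(t+1) is cancelled.
gf-one-last : ∀ B t L → let s = suc t ℕ.+ L in
  (gf B (suc t) (suc L) one ⊝ shift s (gf B (suc t) (suc L) one))
    ≈[ B ] optionalOverline s (gf B (suc t) L one)
gf-one-last B t zero {n} n≤B rewrite ℕₚ.+-identityʳ t =
  gf-one-first B t 0 n≤B
gf-one-last B t (suc L) = cancel-1-qⁱ t (C″ ⊝ shift s C″) (optionalOverline s C′) λ {n} n≤B → begin
  ((C″ ⊝ shift s C″) ⊝ shift u (C″ ⊝ shift s C″)) n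
    ≡⟨ twist-comm u s C″ n ⟩
  ((C″ ⊝ shift u C″) ⊝ shift s (C″ ⊝ shift u C″)) n
    ≡⟨ twist-cong s (gf-one-first B t (suc L)) n≤B ⟩
  (optionalOverline u D′ ⊝ shift s (optionalOverline u D′)) n
    ≡⟨ cong (λ x → optionalOverline u D′ n - x) (shift-overline s u D′ n) ⟩
  (optionalOverline u D′ ⊝ optionalOverline u (shift s D′)) n
    ≡⟨ overline-⊝ u D′ (shift s D′) n ⟨
  optionalOverline u (D′ ⊝ shift s D′) n
    ≡⟨ overline-cong u last n≤B ⟩
  optionalOverline u (optionalOverline s D) n
    ≡⟨ overline-comm u s D n ⟩
  optionalOverline s (optionalOverline u D) n
    ≡⟨ overline-cong s (gf-one-first B t L) n≤B ⟨
  optionalOverline s (C′ ⊝ shift u C′) n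
    ≡⟨ overline-⊝ s C′ (shift u C′) n ⟩
  (optionalOverline s C′ ⊝ optionalOverline s (shift u C′)) n
    ≡⟨ cong (λ x → optionalOverline s C′ n - x) (shift-overline u s C′ n) ⟨
  (optionalOverline s C′ ⊝ shift u (optionalOverline s C′)) n ∎
  where
  u = suc t
  s = suc t ℕ.+ suc L
  C″ = gf B u (suc (suc L)) one
  C′ = gf B u (suc L) one
  D′ = gf B (suc u) (suc L) one
  D  = gf B (suc u) L one
  last : (D′ ⊝ shift s D′) ≈[ B ] optionalOverline s D
  last = subst (λ i → (D′ ⊝ shift i D′) ≈[ B ] optionalOverline i D)
               (cong suc (sym (ℕₚ.+-suc t L))) (gf-one-last B u L)

-- Up to q^n both sides satisfy the same recurrence in L, from the same start, because neither bound
-- truncates below degree n.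
gf-one-bound : ∀ B B′ t L {n} → n ℕ.≤ B → n ℕ.≤ B′ →
               gf B (suc t) L one n ≡ gf B′ (suc t) L one n
gf-one-bound B B′ t zero    n≤B n≤B′ = refl
gf-one-bound B B′ t (suc L) {n} n≤B n≤B′ =
  cancel-1-qⁱ t (gf B (suc t) (suc L) one) (gf B′ (suc t) (suc L) one) {N = n} (λ {m} m≤n → begin
  (gf B (suc t) (suc L) one ⊝ shift (suc t) (gf B (suc t) (suc L) one)) m
    ≡⟨ gf-one-first B t L (ℕₚ.≤-trans m≤n n≤B) ⟩
  optionalOverline (suc t) (gf B (suc (suc t)) L one) m
    ≡⟨ overline-cong (suc t) {N = n} (λ k≤n →
         gf-one-bound B B′ (suc t) L (ℕₚ.≤-trans k≤n n≤B) (ℕₚ.≤-trans k≤n n≤B′)) m≤n ⟩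
  optionalOverline (suc t) (gf B′ (suc (suc t)) L one) m
    ≡⟨ gf-one-first B′ t L (ℕₚ.≤-trans m≤n n≤B′) ⟨
  (gf B′ (suc t) (suc L) one ⊝ shift (suc t) (gf B′ (suc t) (suc L) one)) m ∎) ℕₚ.≤-refl

-- The added part size s exceeds n: both correction terms of `gf-one-last` start at q^s.
gf-one-length-suc : ∀ B t L {n} → n ℕ.≤ B → n ℕ.< suc t ℕ.+ L →
                    gf B (suc t) (suc L) one n ≡ gf B (suc t) L one n
gf-one-length-suc B t L {n} n≤B n<s = begin
  C′ n               ≡⟨ ℤₚ.+-identityʳ _ ⟨
  C′ n - + 0         ≡⟨ cong (λ x → C′ n - x) (shift-vanishes s C′ n<s) ⟨
  C′ n - shift s C′ n ≡⟨ gf-one-last B t L n≤B ⟩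
  C n + shift s C n  ≡⟨ cong (λ x → C n + x) (shift-vanishes s C n<s) ⟩
  C n + + 0          ≡⟨ ℤₚ.+-identityʳ _ ⟩
  C n                ∎
  where
  s = suc t ℕ.+ L
  C = gf B (suc t) L one
  C′ = gf B (suc t) (suc L) one

gf-one-length : ∀ B n d → n ℕ.≤ B → gf B 1 (d ℕ.+ n) one n ≡ gf B 1 n one n
gf-one-length B n zero    n≤B = refl
gf-one-length B n (suc d) n≤B =
  trans (gf-one-length-suc B 0 (d ℕ.+ n) n≤B (s≤s (ℕₚ.m≤n+m n d))) (gf-one-length B n d n≤B)

-- Data with a minimal excludant bounded below

geq : ℕ → ℕ → ℤ
geq zero    i       = + 1
geq (suc k) zero    = + 0
geq (suc k) (suc i) = geq k i

mexGeq : ℕ → OPData → ℤ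
mexGeq k d = geq k (mexIdx d)

-- `mexIdx` reads two entries at a time, so the induction needs the intermediate state just after an
-- odd size was found present. The entry `(1 , false)` stands in for any entry with positive count,
-- and k odd sizes are still required.
afterOdd : ℕ → OPData → ℤ
afterOdd k d = mexGeq (suc k) ((1 , false) ∷ d)

-- Removing one non-overlined copy of each of s, s+2, …, s+2(k-1), where s = t+1.
gf-mexGeq : ∀ B k t L {n} → n ℕ.≤ B → n ℕ.< suc t ℕ.+ L →
  gf B (suc t) L (mexGeq k) n ≡ shift (k ℕ.* (t ℕ.+ k)) (gf B (suc t) L one) n
-- Size t+2 is unrestricted here; the k removed copies are t+3, t+5, ..., with sum k(2+t+k).
gf-afterOdd : ∀ B k t L {n} → n ℕ.≤ B → n ℕ.< suc (suc t) ℕ.+ L →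
  gf B (suc (suc t)) L (afterOdd k) n
  ≡ shift (k ℕ.* (2 ℕ.+ t ℕ.+ k)) (gf B (suc (suc t)) L one) n

gf-mexGeq B zero    t L       n≤B n<s = refl
-- With no entries left but sizes still required, the left side is 0. The right side starts at
-- q^((k+1)(t+k+1)), beyond n ≤ t.
gf-mexGeq B (suc k) t zero    {n} n≤B n<s = sym (shift-vanishes (suc k ℕ.* (t ℕ.+ suc k)) _
  (ℕₚ.<-≤-trans n<s (ℕₚ.≤-trans (ℕₚ.≤-reflexive (trans (ℕₚ.+-identityʳ (suc t)) (sym (ℕₚ.+-comm t 1))))
    (ℕₚ.≤-trans (ℕₚ.+-monoʳ-≤ t (s≤s z≤n)) (ℕₚ.m≤m+n _ _)))))
gf-mexGeq B (suc k) t (suc L) {n} n≤B n<s = cancel-1-qⁱ t E (shift e′ C) {N = n} (λ {m} m≤n → begin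
  (E ⊝ shift s E) m
    ≡⟨ gf-positiveCount B t L (mexGeq (suc k)) (afterOdd k) (λ _ _ → refl) after (ℕₚ.≤-trans m≤n n≤B) ⟩
  shift s (optionalOverline s (gf B (suc s) L (afterOdd k))) m
    ≡⟨ shift-cong s (overline-cong s {N = n} (λ l≤n → gf-afterOdd B k t L (ℕₚ.≤-trans l≤n n≤B)
         (ℕₚ.≤-<-trans l≤n (ℕₚ.<-≤-trans n<s (ℕₚ.≤-reflexive (ℕₚ.+-suc s L)))))) m≤n ⟩
  shift s (optionalOverline s (shift e D)) m
    ≡⟨ shift-overline s s (shift e D) m ⟩
  optionalOverline s (shift s (shift e D)) m
    ≡⟨ overline-cong s {N = n} (λ {l} _ → trans (shift-shift s e D l) (shift-index D l (exponent k t))) m≤n ⟩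
  optionalOverline s (shift e′ D) m
    ≡⟨ shift-overline e′ s D m ⟨
  shift e′ (optionalOverline s D) m
    ≡⟨ shift-cong e′ {N = n} (λ l≤n → gf-one-first B t L (ℕₚ.≤-trans l≤n n≤B)) m≤n ⟨
  shift e′ (C ⊝ shift s C) m
    ≡⟨ shift-twisted e′ s C m ⟩
  (shift e′ C ⊝ shift s (shift e′ C)) m ∎) ℕₚ.≤-refl
  where
  s = suc t
  e = k ℕ.* (2 ℕ.+ t ℕ.+ k)
  e′ = suc k ℕ.* (t ℕ.+ suc k)
  E = gf B s (suc L) (mexGeq (suc k))
  C = gf B s (suc L) one
  D = gf B (suc s) L one
  exponent : ∀ k t → suc t ℕ.+ k ℕ.* (2 ℕ.+ t ℕ.+ k) ≡ suc k ℕ.* (t ℕ.+ suc k)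
  exponent = ℕ-Solver.solve-∀
  after : ∀ c o d → mexGeq (suc k) ((suc c , o) ∷ d) ≡ afterOdd k d
  after c o []      = refl
  after c o (_ ∷ _) = refl

gf-afterOdd B zero    t zero    n≤B n<s = refl
gf-afterOdd B (suc k) t zero    {n} n≤B n<s = sym (shift-vanishes (suc k ℕ.* (2 ℕ.+ t ℕ.+ suc k)) _
  (ℕₚ.<-≤-trans n<s (ℕₚ.≤-trans (ℕₚ.+-monoʳ-≤ (2 ℕ.+ t) z≤n) (ℕₚ.m≤m+n _ _))))
gf-afterOdd B k t (suc L) {n} n≤B n<s = cancel-1-qⁱ (suc t) E (shift e C) {N = n} (λ {m} m≤n → begin
  (E ⊝ shift s E) m
    ≡⟨ gf-anyCount B (suc t) L (afterOdd k) (mexGeq k) (λ _ _ _ → refl) (ℕₚ.≤-trans m≤n n≤B) ⟩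
  optionalOverline s (gf B (suc s) L (mexGeq k)) m
    ≡⟨ overline-cong s {N = n} (λ l≤n → gf-mexGeq B k s L (ℕₚ.≤-trans l≤n n≤B)
         (ℕₚ.≤-<-trans l≤n (ℕₚ.<-≤-trans n<s (ℕₚ.≤-reflexive (ℕₚ.+-suc s L))))) m≤n ⟩
  optionalOverline s (shift e D) m
    ≡⟨ shift-overline e s D m ⟨
  shift e (optionalOverline s D) m
    ≡⟨ shift-cong e {N = n} (λ l≤n → gf-one-first B (suc t) L (ℕₚ.≤-trans l≤n n≤B)) m≤n ⟨
  shift e (C ⊝ shift s C) m
    ≡⟨ shift-twisted e s C m ⟩
  (shift e C ⊝ shift s (shift e C)) m ∎) ℕₚ.≤-refl
  where
  s = suc (suc t)
  e = k ℕ.* (s ℕ.+ k)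
  E = gf B s (suc L) (afterOdd k)
  C = gf B s (suc L) one
  D = gf B (suc s) L one

-- Counting by minimal excludant

pbarSeries : Series
pbarSeries n = + pbar (+ n)

pbarSeries-gf : ∀ n → pbarSeries n ≡ gf n 1 n one n
pbarSeries-gf n = trans (length-filter (λ d → weight d ℕ.≟ n) (allData n n))
  (sumOver-cong (λ d → sym (ℤₚ.*-identityˡ (𝟙 (weight d ≡ᵇ n)))) (allData n n))

-- `pbar` at m enumerates with length and multiplicity bound m; enlarging both to n changes no
-- coefficient up to q^m.
gf-pbar : ∀ n → gf n 1 n one ≈[ n ] pbarSeries
gf-pbar n {m} m≤n = begin
  gf n 1 n one m              ≡⟨ cong (λ L → gf n 1 L one m) (ℕₚ.m∸n+n≡m m≤n) ⟨
  gf n 1 (n ℕ.∸ m ℕ.+ m) one m ≡⟨ gf-one-length n m (n ℕ.∸ m) m≤n ⟩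
  gf n 1 m one m              ≡⟨ gf-one-bound n m 0 m m≤n ℕₚ.≤-refl ⟩
  gf m 1 m one m              ≡⟨ pbarSeries-gf m ⟨
  pbarSeries m                ∎

-- The value 0 of `pbar` at negative arguments is the zero that `shift` fills in.
shift-pbar : ∀ i n → shift i pbarSeries n ≡ + pbar (+ n - + i)
shift-pbar i n = trans (go i n) (cong (λ j → + pbar j) (sym (ℤₚ.m-n≡m⊖n n i)))
  where
  go : ∀ i n → shift i pbarSeries n ≡ + pbar (n ⊖ i)
  go zero    n       = refl
  go (suc i) zero    = refl
  go (suc i) (suc n) = trans (go i n) (cong (λ j → + pbar j) (sym (ℤₚ.[1+m]⊖[1+n]≡m⊖n n i)))

-- Gauss's identity in positive degree: p_0 counts only the empty data, so it is the series 1 and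
-- its coefficient at q^(n+1) is 0.
theta-pbar : ∀ n → theta (suc n) pbarSeries (suc n) ≡ + 0
theta-pbar n = begin
  theta N pbarSeries N           ≡⟨ theta-cong N (gf-pbar N) {N} ℕₚ.≤-refl ⟨
  theta N (gf N 1 N one) N       ≡⟨ Gauss.theta-p-diagonal N (λ L → gf N 1 L one) (λ L → gf-one-last N 0 L) ⟩
  gf N 1 0 one N                 ≡⟨⟩
  + 0                            ∎
  where N = suc n

residue : ℕ → ℕ
residue 0             = 1
residue 1             = 3
residue (suc (suc i)) = residue i

residue-spec : ∀ i → (2 ℕ.* i ℕ.+ 1) % 4 ≡ residue i
residue-spec 0             = refl
residue-spec 1             = refl
residue-spec (suc (suc i)) = begin
  (2 ℕ.* suc (suc i) ℕ.+ 1) % 4 ≡⟨ cong (_% 4) (lemma i) ⟩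
  (2 ℕ.* i ℕ.+ 1 ℕ.+ 4) % 4     ≡⟨ [m+n]%n≡m%n (2 ℕ.* i ℕ.+ 1) 4 ⟩
  (2 ℕ.* i ℕ.+ 1) % 4           ≡⟨ residue-spec i ⟩
  residue i                     ∎
  where
  lemma : ∀ i → 2 ℕ.* suc (suc i) ℕ.+ 1 ≡ 2 ℕ.* i ℕ.+ 1 ℕ.+ 4
  lemma = ℕ-Solver.solve-∀

-- Each step exchanges the residues 1 and 3, so equality survives a simultaneous step.
residue-suc : ∀ i k → (residue (suc i) ≡ᵇ residue (suc k)) ≡ (residue i ≡ᵇ residue k)
residue-suc 0 0 = refl
residue-suc 0 1 = refl
residue-suc 1 0 = refl
residue-suc 1 1 = refl
residue-suc 0 (suc (suc k)) = residue-suc 0 k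
residue-suc 1 (suc (suc k)) = residue-suc 1 k
residue-suc (suc (suc i)) k = residue-suc i k

opIndicator : ℕ → ℕ → ℤ
opIndicator k i = 𝟙 ((k ≤ᵇ i) ∧ (residue i ≡ᵇ residue k))

opIndicator-suc : ∀ k i → opIndicator (suc k) (suc i) ≡ opIndicator k i
opIndicator-suc k i = cong 𝟙 (cong₂ _∧_ (≤ᵇ-suc k i) (residue-suc i k))
  where
  ≤ᵇ-suc : ∀ k i → (suc k ≤ᵇ suc i) ≡ (k ≤ᵇ i)
  ≤ᵇ-suc zero    i = refl
  ≤ᵇ-suc (suc k) i = refl

-- The residues of k and k+1 differ, so every i ≥ k matches exactly one of them. At i = k it is the
-- first, so the stricter bound in the second indicator loses nothing.
opIndicator-pair : ∀ k i → opIndicator k i + opIndicator (suc k) i ≡ geq k i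
opIndicator-pair zero    zero    = refl
opIndicator-pair zero    (suc i) = residue-pair (suc i)
  where
  residue-pair : ∀ i → 𝟙 (residue i ≡ᵇ 1) + 𝟙 (residue i ≡ᵇ 3) ≡ + 1
  residue-pair 0             = refl
  residue-pair 1             = refl
  residue-pair (suc (suc i)) = residue-pair i
opIndicator-pair (suc k) zero    = refl
opIndicator-pair (suc k) (suc i) =
  trans (cong₂ _+_ (opIndicator-suc k i) (opIndicator-suc (suc k) i)) (opIndicator-pair k i)

op21-sum : ∀ n k → + op21 n k ≡
  sumOver (λ d → opIndicator k (mexIdx d) * 𝟙 (weight d ≡ᵇ n)) (allData n n)
op21-sum n k = begin
  + op21 n k
    ≡⟨ length-filter Q? (overpartitions n) ⟩
  sumOver (𝟙 ∘ does ∘ Q?) (overpartitions n)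
    ≡⟨ sumOver-cong (λ d → cong 𝟙 (indicator d)) (overpartitions n) ⟩
  sumOver (λ d → opIndicator k (mexIdx d)) (overpartitions n)
    ≡⟨ sumOver-filter (λ d → weight d ℕ.≟ n) (λ d → opIndicator k (mexIdx d)) (allData n n) ⟩
  sumOver (λ d → opIndicator k (mexIdx d) * 𝟙 (weight d ≡ᵇ n)) (allData n n) ∎
  where
  Q? = λ d → ((2 ℕ.* k ℕ.+ 1) ℕ.≤? mex21 d) ×-dec (mex21 d % 4 ℕ.≟ (2 ℕ.* k ℕ.+ 1) % 4)

  indicator : ∀ d → does (Q? d) ≡ ((k ≤ᵇ mexIdx d) ∧ (residue (mexIdx d) ≡ᵇ residue k))
  indicator d = cong₂ _∧_
    (does-⇔ (mk⇔ (λ le → ℕₚ.*-cancelˡ-≤ 2 (ℕₚ.+-cancelʳ-≤ 1 _ _ le))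
                 (λ le → ℕₚ.+-monoˡ-≤ 1 (ℕₚ.*-monoʳ-≤ 2 le)))
            ((2 ℕ.* k ℕ.+ 1) ℕ.≤? mex21 d) (k ℕ.≤? mexIdx d))
    (cong₂ _≡ᵇ_ (residue-spec (mexIdx d)) (residue-spec k))

-- The two indicators add up to the condition `mexIdx` ≥ k, and the removed parts 1, 3, ..., 2k-1
-- have sum k².
op21-pair : ∀ n k → + op21 n k + + op21 n (suc k) ≡ shift (k ℕ.* k) pbarSeries n
op21-pair n k = begin
  + op21 n k + + op21 n (suc k)
    ≡⟨ cong₂ _+_ (op21-sum n k) (op21-sum n (suc k)) ⟩
  sumOver (W k) (allData n n) + sumOver (W (suc k)) (allData n n)
    ≡⟨ sumOver-+ (W k) (W (suc k)) (allData n n) ⟨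
  sumOver (λ d → W k d + W (suc k) d) (allData n n)
    ≡⟨ sumOver-cong (λ d → trans
         (sym (ℤₚ.*-distribʳ-+ (𝟙 (weight d ≡ᵇ n)) (opIndicator k (mexIdx d)) (opIndicator (suc k) (mexIdx d))))
         (cong (_* 𝟙 (weight d ≡ᵇ n)) (opIndicator-pair k (mexIdx d)))) (allData n n) ⟩
  gf n 1 n (mexGeq k) n
    ≡⟨ gf-mexGeq n k 0 n ℕₚ.≤-refl ℕₚ.≤-refl ⟩
  shift (k ℕ.* k) (gf n 1 n one) n
    ≡⟨ shift-cong (k ℕ.* k) (gf-pbar n) ℕₚ.≤-refl ⟩
  shift (k ℕ.* k) pbarSeries n ∎
  where W = λ k d → opIndicator k (mexIdx d) * 𝟙 (weight d ≡ᵇ n)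

-- Alternating sums over integer intervals

sg-square : ∀ i → sg i * sg i ≡ + 1
sg-square zero    = refl
sg-square (suc i) = trans (lemma (sg i)) (sg-square i)
  where
  lemma : ∀ x → - x * - x ≡ x * x
  lemma = solve-∀

sg-+ : ∀ i j → sg (i ℕ.+ j) ≡ sg i * sg j
sg-+ zero    j = sym (ℤₚ.*-identityˡ (sg j))
sg-+ (suc i) j = trans (cong -_ (sg-+ i j)) (ℤₚ.neg-distribˡ-* (sg i) (sg j))

sg-⊖ : ∀ i j → sg ∣ i ⊖ j ∣ ≡ sg i * sg j
sg-⊖ zero    zero    = refl
sg-⊖ zero    (suc j) = sym (ℤₚ.*-identityˡ (sg (suc j)))
sg-⊖ (suc i) zero    = sym (ℤₚ.*-identityʳ (sg (suc i)))
sg-⊖ (suc i) (suc j) = begin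
  sg ∣ suc i ⊖ suc j ∣ ≡⟨ cong (sg ∘ ∣_∣) (ℤₚ.[1+m]⊖[1+n]≡m⊖n i j) ⟩
  sg ∣ i ⊖ j ∣         ≡⟨ sg-⊖ i j ⟩
  sg i * sg j          ≡⟨ lemma (sg i) (sg j) ⟩
  - sg i * - sg j      ∎
  where
  lemma : ∀ x y → x * y ≡ - x * - y
  lemma = solve-∀

-- The leading sign of the theorem squares away on one end of the telescope and leaves (-1)^(m+k),
-- passed as `s`, on the other.
cancel-sg : ∀ i j x y {s} → s ≡ sg i * sg j → sg i * (sg i * x + sg j * y) ≡ x + s * y
cancel-sg i j x y refl = begin
  sg i * (sg i * x + sg j * y)
    ≡⟨ lemma (sg i) (sg j) x y ⟩
  (sg i * sg i) * x + (sg i * sg j) * y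
    ≡⟨ cong (λ z → z * x + (sg i * sg j) * y) (sg-square i) ⟩
  + 1 * x + (sg i * sg j) * y
    ≡⟨ cong (_+ (sg i * sg j) * y) (ℤₚ.*-identityˡ x) ⟩
  x + (sg i * sg j) * y ∎
  where
  lemma : ∀ e f x y → e * (e * x + f * y) ≡ (e * e) * x + (e * f) * y
  lemma = solve-∀

sgn-sg : ∀ j → sgn j ≡ sg ∣ j ∣
sgn-sg (+ n)    = nonneg n
  where
  nonneg : ∀ n → sgn (+ n) ≡ sg n
  nonneg 0             = refl
  nonneg 1             = refl
  nonneg (suc (suc n)) = trans (nonneg n) (sym (ℤₚ.neg-involutive (sg n)))
sgn-sg -[1+ n ] = sgn-sg (+ suc n)

sgn-+ : ∀ i j → sgn (i + j) ≡ sg ∣ i ∣ * sg ∣ j ∣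
sgn-+ i j = trans (sgn-sg (i + j)) (go i j)
  where
  go : ∀ i j → sg ∣ i + j ∣ ≡ sg ∣ i ∣ * sg ∣ j ∣
  go (+ a)    (+ b)    = sg-+ a b
  go (+ a)    -[1+ b ] = sg-⊖ a (suc b)
  go -[1+ a ] (+ b)    = trans (sg-⊖ b (suc a)) (ℤₚ.*-comm (sg b) (sg (suc a)))
  go -[1+ a ] -[1+ b ] = trans (cong sg (sym (ℕₚ.+-suc (suc a) b))) (sg-+ (suc a) (suc b))

square-∣∣ : ∀ j → j * j ≡ + (∣ j ∣ ℕ.* ∣ j ∣)
square-∣∣ (+ n)    = sym (ℤₚ.pos-* n n)
square-∣∣ -[1+ n ] = refl

sumFrom-telescope : ∀ {f} (A : ℤ → ℤ) → (∀ j → f j ≡ A (j + + 1) - A j) →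
                    ∀ m l → sumFrom m l f ≡ A (m + + l) - A m
sumFrom-telescope A step m zero rewrite ℤₚ.+-identityʳ m = sym (ℤₚ.+-inverseʳ (A m))
sumFrom-telescope {f} A step m (suc l) = begin
  f m + sumFrom (m + + 1) l f
    ≡⟨ cong₂ _+_ (step m) (sumFrom-telescope A step (m + + 1) l) ⟩
  (A (m + + 1) - A m) + (A (m + + 1 + + l) - A (m + + 1))
    ≡⟨ cong (λ x → (A (m + + 1) - A m) + (A x - A (m + + 1))) (ℤₚ.+-assoc m (+ 1) (+ l)) ⟩
  (A (m + + 1) - A m) + (A (m + + suc l) - A (m + + 1))
    ≡⟨ lemma (A (m + + 1)) (A m) (A (m + + suc l)) ⟩
  A (m + + suc l) - A m ∎
  where
  lemma : ∀ x y z → (x - y) + (z - x) ≡ z - y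
  lemma = solve-∀

-- By m ≤ k the number of terms is k - m + 1, so the telescope ends at k + 1.
sumFromTo-telescope : ∀ {f} (A : ℤ → ℤ) → (∀ j → f j ≡ A (j + + 1) - A j) →
                      ∀ {m k} → m ≤ k → sumFromTo m k f ≡ A (k + + 1) - A m
sumFromTo-telescope A step {m} {k} m≤k =
  trans (sumFrom-telescope A step m (suc ∣ k - m ∣)) (cong (λ j → A j - A m) (begin
    m + (+ 1 + + ∣ k - m ∣) ≡⟨ cong (λ x → m + (+ 1 + x)) (ℤₚ.0≤i⇒+∣i∣≡i (ℤₚ.i≤j⇒0≤j-i m≤k)) ⟩
    m + (+ 1 + (k - m))     ≡⟨ lemma m k ⟩
    k + + 1                 ∎))
  where
  lemma : ∀ m k → m + (+ 1 + (k - m)) ≡ k + + 1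
  lemma = solve-∀

-- An antidifference of the summand for fixed n ≥ 1

module Telescope (n-1 : ℕ) where

  n = suc n-1

  o : ℕ → ℤ
  o k = + op21 n k

  summand : ℤ → ℤ
  summand j = sgn j * + pbar (+ n - j * j)

  summand-o : ∀ j → summand j ≡ sg ∣ j ∣ * (o ∣ j ∣ + o (suc ∣ j ∣))
  summand-o j = cong₂ _*_ (sgn-sg j) (begin
    + pbar (+ n - j * j)                    ≡⟨ cong (λ x → + pbar (+ n - x)) (square-∣∣ j) ⟩
    + pbar (+ n - + (∣ j ∣ ℕ.* ∣ j ∣))      ≡⟨ shift-pbar (∣ j ∣ ℕ.* ∣ j ∣) n ⟨
    shift (∣ j ∣ ℕ.* ∣ j ∣) pbarSeries n    ≡⟨ op21-pair n ∣ j ∣ ⟨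
    o ∣ j ∣ + o (suc ∣ j ∣)                 ∎)

  -- Twice the telescope over j = 0, ..., r, less the term j = 0, which occurs only once.
  theta-o : ∀ r → theta r pbarSeries n ≡ o 0 - o 1 + + 2 * (sg r * o (suc r))
  theta-o zero    = trans (sym (op21-pair n 0)) (lemma (o 0) (o 1))
    where
    lemma : ∀ x y → x + y ≡ x - y + + 2 * (+ 1 * y)
    lemma = solve-∀
  theta-o (suc r) = begin
    theta r pbarSeries n + (+ 2 * - sg r) * shift (suc r ℕ.* suc r) pbarSeries n
      ≡⟨ cong₂ (λ x y → x + (+ 2 * - sg r) * y) (theta-o r) (sym (op21-pair n (suc r))) ⟩
    o 0 - o 1 + + 2 * (sg r * o (suc r)) + (+ 2 * - sg r) * (o (suc r) + o (suc (suc r)))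
      ≡⟨ lemma (o 0) (o 1) (sg r) (o (suc r)) (o (suc (suc r))) ⟩
    o 0 - o 1 + + 2 * (- sg r * o (suc (suc r))) ∎
    where
    lemma : ∀ x y e z w → x - y + + 2 * (e * z) + (+ 2 * - e) * (z + w)
                          ≡ x - y + + 2 * (- e * w)
    lemma = solve-∀

  -- The pair sum for k = n+1 is a coefficient below degree (n+1)², hence 0, and both summands are
  -- natural numbers.
  o-vanishes : o (suc n) ≡ + 0
  o-vanishes = cong +_ (ℕₚ.m+n≡0⇒m≡0 (op21 n (suc n)) (ℤₚ.+-injective
    (trans (op21-pair n (suc n))
           (shift-vanishes (suc n ℕ.* suc n) pbarSeries (s≤s (ℕₚ.m≤m+n n _))))))

  -- At r = n the last term of `theta-o` vanishes, leaving `o 0 - o 1`; by Gauss's identity the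
  -- theta side is 0, since n ≥ 1.
  o-0≡1 : o 0 ≡ o 1
  o-0≡1 = ℤₚ.i-j≡0⇒i≡j (o 0) (o 1) (begin
    o 0 - o 1                              ≡⟨ lemma (o 0 - o 1) (sg n) ⟩
    o 0 - o 1 + + 2 * (sg n * + 0)         ≡⟨ cong (λ x → o 0 - o 1 + + 2 * (sg n * x)) o-vanishes ⟨
    o 0 - o 1 + + 2 * (sg n * o (suc n))   ≡⟨ theta-o n ⟨
    theta n pbarSeries n                   ≡⟨ theta-pbar n-1 ⟩
    + 0                                    ∎)
    where
    lemma : ∀ x e → x ≡ x + + 2 * (e * + 0)
    lemma = solve-∀

  -- An antidifference of the summand; the two formulas agree at 0 because o 0 ≡ o 1.
  A : ℤ → ℤ
  A (+ j)    = - (sg j * o j)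
  A -[1+ i ] = - (sg (suc i) * o (suc (suc i)))

  A-nonpos : ∀ i → A (- + i) ≡ - (sg i * o (suc i))
  A-nonpos zero    = cong (λ x → - (+ 1 * x)) o-0≡1
  A-nonpos (suc i) = refl

  -[1+]+1 : ∀ i → -[1+ i ] + + 1 ≡ - + i
  -[1+]+1 zero    = refl
  -[1+]+1 (suc i) = refl

  -- On the negative side the step from -1 reaches `A` at 0, which is defined by the other formula;
  -- `A-nonpos` bridges this junction.
  A-step : ∀ j → summand j ≡ A (j + + 1) - A j
  A-step (+ j) = trans (summand-o (+ j)) (trans (lemma (sg j) (o j) (o (suc j)))
    (cong (λ i → A (+ i) - A (+ j)) (ℕₚ.+-comm 1 j)))
    where
    lemma : ∀ e x y → e * (x + y) ≡ - (- e * y) - - (e * x)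
    lemma = solve-∀
  A-step -[1+ i ] = trans (summand-o -[1+ i ]) (trans (lemma (sg i) (o (suc i)) (o (suc (suc i))))
    (cong (λ x → x - A -[1+ i ]) (sym (trans (cong A (-[1+]+1 i)) (A-nonpos i)))))
    where
    lemma : ∀ e x y → - e * (x + y) ≡ - (e * x) - - (- e * y)
    lemma = solve-∀

  sum-A : ∀ {m k} → m ≤ k → sumFromTo m k summand ≡ A (k + + 1) - A m
  sum-A = sumFromTo-telescope A A-step

  Sum : ℤ → ℤ → ℤ
  Sum m k = sgn ((+ ∣ m ∣) ⊓ k) * sumFromTo m k summand

  end-+ : ∀ b → A (+ b + + 1) ≡ sg b * o (suc b)
  end-+ b = trans (cong (λ i → A (+ i)) (ℕₚ.+-comm b 1)) (lemma (sg b) (o (suc b)))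
    where
    lemma : ∀ e x → - (- e * x) ≡ e * x
    lemma = solve-∀

  Sum-nonneg : ∀ {a b} → a ℕ.≤ b →
    Sum (+ a) (+ b) ≡ o a + sgn (+ a + + b) * o (suc b)
  Sum-nonneg {a} {b} a≤b = begin
    sgn (+ (a ℕ.⊓ b)) * sumFromTo (+ a) (+ b) summand
      ≡⟨ cong₂ _*_ (trans (cong (sgn ∘ +_) (ℕₚ.m≤n⇒m⊓n≡m a≤b)) (sgn-sg (+ a))) (sum-A (+≤+ a≤b)) ⟩
    sg a * (A (+ b + + 1) - A (+ a))
      ≡⟨ cong (λ x → sg a * (x - A (+ a))) (end-+ b) ⟩
    sg a * (sg b * o (suc b) - - (sg a * o a))
      ≡⟨ cong (sg a *_) (lemma (sg b * o (suc b)) (sg a * o a)) ⟩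
    sg a * (sg a * o a + sg b * o (suc b))
      ≡⟨ cancel-sg a b (o a) (o (suc b)) (sgn-+ (+ a) (+ b)) ⟩
    o a + sgn (+ a + + b) * o (suc b) ∎
    where
    lemma : ∀ x y → x - - y ≡ y + x
    lemma = solve-∀

  -- For k < 0 the minimum of |m| and k is k itself, so the leading sign cancels that of the upper
  -- end of the telescope.
  Sum-neg : ∀ {a b} → b ℕ.≤ a →
    Sum -[1+ a ] -[1+ b ] ≡ o (suc b) + sgn (-[1+ a ] + -[1+ b ]) * o (suc (suc a))
  Sum-neg {a} {b} b≤a = begin
    sgn -[1+ b ] * sumFromTo -[1+ a ] -[1+ b ] summand
      ≡⟨ cong₂ _*_ (sgn-sg -[1+ b ]) (sum-A (-≤- b≤a)) ⟩
    sg (suc b) * (A (-[1+ b ] + + 1) - A -[1+ a ])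
      ≡⟨ cong (λ x → sg (suc b) * (x - A -[1+ a ])) (trans (cong A (-[1+]+1 b)) (A-nonpos b)) ⟩
    sg (suc b) * (- (sg b * o (suc b)) - - (sg (suc a) * o (suc (suc a))))
      ≡⟨ cong (sg (suc b) *_) (lemma (sg b) (o (suc b)) (sg (suc a) * o (suc (suc a)))) ⟩
    sg (suc b) * (sg (suc b) * o (suc b) + sg (suc a) * o (suc (suc a)))
      ≡⟨ cancel-sg (suc b) (suc a) (o (suc b)) (o (suc (suc a)))
           (trans (sgn-+ -[1+ a ] -[1+ b ]) (ℤₚ.*-comm (sg (suc a)) (sg (suc b)))) ⟩
    o (suc b) + sgn (-[1+ a ] + -[1+ b ]) * o (suc (suc a)) ∎
    where
    lemma : ∀ e x y → - (e * x) - - y ≡ - e * x + y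
    lemma = solve-∀

  -- The ends contribute `o` at |m|+1 and k+1 with signs (-1)^m and (-1)^k. The leading sign belongs
  -- to the smaller of |m| and k, hence the two cases.
  Sum-mixed : ∀ a b → Sum -[1+ a ] (+ b) ≡
    o (suc (suc a ℕ.⊓ b)) + sgn (-[1+ a ] + + b) * o (suc (suc a ℕ.⊔ b))
  Sum-mixed a b with ℕₚ.≤-total (suc a) b
  ... | inj₁ a<b rewrite ℕₚ.m≤n⇒m⊓n≡m a<b | ℕₚ.m≤n⇒m⊔n≡n a<b = begin
    sgn (+ suc a) * sumFromTo -[1+ a ] (+ b) summand
      ≡⟨ cong₂ _*_ (sgn-sg (+ suc a)) (trans (sum-A (-≤+ {a} {b})) (cong (_- A -[1+ a ]) (end-+ b))) ⟩
    sg (suc a) * (sg b * o (suc b) - - (sg (suc a) * o (suc (suc a))))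
      ≡⟨ cong (sg (suc a) *_) (lemma (sg b * o (suc b)) (sg (suc a) * o (suc (suc a)))) ⟩
    sg (suc a) * (sg (suc a) * o (suc (suc a)) + sg b * o (suc b))
      ≡⟨ cancel-sg (suc a) b (o (suc (suc a))) (o (suc b)) (sgn-+ -[1+ a ] (+ b)) ⟩
    o (suc (suc a)) + sgn (-[1+ a ] + + b) * o (suc b) ∎
    where
    lemma : ∀ x y → x - - y ≡ y + x
    lemma = solve-∀
  ... | inj₂ b≤a rewrite ℕₚ.m≥n⇒m⊓n≡n b≤a | ℕₚ.m≥n⇒m⊔n≡m b≤a = begin
    sgn (+ b) * sumFromTo -[1+ a ] (+ b) summand
      ≡⟨ cong₂ _*_ (sgn-sg (+ b)) (trans (sum-A (-≤+ {a} {b})) (cong (_- A -[1+ a ]) (end-+ b))) ⟩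
    sg b * (sg b * o (suc b) - - (sg (suc a) * o (suc (suc a))))
      ≡⟨ cong (λ x → sg b * (sg b * o (suc b) + x)) (ℤₚ.neg-involutive (sg (suc a) * o (suc (suc a)))) ⟩
    sg b * (sg b * o (suc b) + sg (suc a) * o (suc (suc a)))
      ≡⟨ cancel-sg b (suc a) (o (suc b)) (o (suc (suc a)))
           (trans (sgn-+ -[1+ a ] (+ b)) (ℤₚ.*-comm (sg (suc a)) (sg b))) ⟩
    o (suc b) + sgn (-[1+ a ] + + b) * o (suc (suc a)) ∎

-- Case distinction on the signs of m and k

theorem2p4 : (n : ℕ) → 1 ℕ.≤ n → (m k : ℤ) → m ≤ k →
    (0ℤ < m * k →
    sgn ((+ ∣ m ∣) ⊓ k) * sumFromTo m k (λ j → sgn j * + pbar (+ n - j * j))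
    ≡ + op21 n (∣ m ∣ ℕ.⊓ ∣ k ∣) + sgn (m + k) * + op21 n (ℕ.suc (∣ m ∣ ℕ.⊔ ∣ k ∣)))
    ×
    (m * k ≤ 0ℤ →
    sgn ((+ ∣ m ∣) ⊓ k) * sumFromTo m k (λ j → sgn j * + pbar (+ n - j * j))
    ≡ + op21 n (ℕ.suc (∣ m ∣ ℕ.⊓ ∣ k ∣)) + sgn (m + k) * + op21 n (ℕ.suc (∣ m ∣ ℕ.⊔ ∣ k ∣)))
theorem2p4 (suc n) _ (+ zero) (+ b) (+≤+ a≤b) =
  (λ { (+<+ ()) }) ,
  -- The telescope from m = 0 yields `o 0` where the case mk ≤ 0 asks for `o 1`.
  (λ _ → trans (Sum-nonneg a≤b) (cong (_+ sgn (+ b) * o (suc b)) o-0≡1))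
  where open Telescope n
theorem2p4 (suc n) _ (+ suc a) (+ suc b) (+≤+ a≤b) =
  (λ _ → trans (Sum-nonneg a≤b)
    (cong₂ (λ i j → o i + sgn (+ suc a + + suc b) * o (suc j))
           (sym (ℕₚ.m≤n⇒m⊓n≡m a≤b)) (sym (ℕₚ.m≤n⇒m⊔n≡n a≤b)))) ,
  (λ { (+≤+ ()) })
  where open Telescope n
theorem2p4 (suc n) _ -[1+ a ] -[1+ b ] (-≤- b≤a)
  rewrite ℕₚ.m≥n⇒m⊓n≡n b≤a | ℕₚ.m≥n⇒m⊔n≡m b≤a =
  (λ _ → Sum-neg b≤a) , (λ { (+≤+ ()) })
  where open Telescope n
theorem2p4 (suc n) _ -[1+ a ] (+ zero) -≤+ =
  (λ 0<m*k → contradiction (sym (ℤₚ.*-zeroʳ -[1+ a ])) (ℤₚ.<⇒≢ 0<m*k)) , (λ _ → Sum-mixed a 0)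
  where open Telescope n
theorem2p4 (suc n) _ -[1+ a ] (+ suc b) -≤+ =
  (λ ()) , (λ _ → Sum-mixed a (suc b))
  where open Telescope n
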